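{- If a graph $G$ has the *-C1P, then $\operatorname{pe}(G)\le 1$.
   Context: All graphs are finite and simple; the notion $\operatorname{pe}(G)$ is used for connected graphs $G$. A graph $G$ has the partially augmented consecutive ones property (*-C1P) if there is a linear ordering of $V(G)$ such that for every vertex $u$, at least one of the open neighborhood $N(u)$ or the closed neighborhood $N[u]$ forms a set of consecutive vertices in this ordering. For a connected graph $G$ and a path $P$ in $G$, the eccentricity of $P$ is the maximum over all vertices $v$ of $G$ of the distance from $v$ to $V(P)$; $\operatorname{pe}(G)$ is the minimum eccentricity of a path in $G$. -}

module Defs where

open import Data.Nat using (ℕ; zero; suc; _≤_; _<_)
open import Data.Fin using (Fin; toℕ)
open import Data.List using (List; []; _∷_)
open import Data.List.Membership.Propositional using (_∈_)
open import Data.List.Relation.Unary.Unique.Propositional using (Unique)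
open import Data.List.Relation.Unary.Linked using (Linked)
open import Data.Product using (Σ; ∃; ∃-syntax; _×_)
open import Data.Sum using (_⊎_)
open import Data.Empty using (⊥)
open import Function.Bundles using (_⤖_; Bijection)
open import Relation.Binary.PropositionalEquality using (_≡_)
open import Relation.Nullary using (¬_)

record Graph (n : ℕ) : Set₁ where
  field
    Adj    : Fin n → Fin n → Set
    sym    : ∀ {u v} → Adj u v → Adj v u
    irrefl : ∀ {u} → ¬ Adj u u

module _ {n : ℕ} (G : Graph n) where
  open Graph G

  N : Fin n → Fin n → Set
  N u v = Adj u v

  N[_] : Fin n → Fin n → Set
  N[ u ] v = (u ≡ v) ⊎ Adj u v

  -- A linear ordering of V(G): a bijection pos : V(G) → {0,…,n-1}
  -- giving the position of each vertex.
  -- A set S is consecutive in that ordering if whenever a, c ∈ S and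
  -- b lies strictly between them, b ∈ S.
  Consecutive : (Fin n ⤖ Fin n) → (Fin n → Set) → Set
  Consecutive σ S =
    ∀ a b c → toℕ (pos a) < toℕ (pos b) → toℕ (pos b) < toℕ (pos c) →
      S a → S c → S b
    where pos = Bijection.to σ

  StarC1P : Set
  StarC1P = ∃[ σ ] (∀ u → Consecutive σ (N u) ⊎ Consecutive σ (N[ u ]))

  data Walk : Fin n → Fin n → ℕ → Set where
    []  : ∀ {u} → Walk u u zero
    _∷_ : ∀ {u v w k} → Adj u v → Walk v w k → Walk u w (suc k)

  Connected : Set
  Connected = ∀ u v → ∃[ k ] Walk u v k

  Dist≤ : Fin n → Fin n → ℕ → Set
  Dist≤ u v k = ∃[ m ] (m ≤ k × Walk u v m)

  IsPath : List (Fin n) → Set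
  IsPath P = ¬ (P ≡ []) × Unique P × Linked Adj P

  Ecc≤ : List (Fin n) → ℕ → Set
  Ecc≤ P k = ∀ v → ∃[ w ] (w ∈ P × Dist≤ v w k)

  pe≤ : ℕ → Set
  pe≤ k = ∃[ P ] (IsPath P × Ecc≤ P k)

{-# OPTIONS --safe #-}
-- The *-C1P is used only in the form: if a < b < c, u ~ a, u ~ c and u ≠ b, then u ~ b. Adjacency
-- need not be decidable, so G is replaced by a decidable connected subgraph, the closure of
-- finitely many edges under this rule.
--
-- Let s and t be the first and the last vertex, and P a path with an edge such that every vertex
-- of P, as well as s and t, has a neighbour on P. If v has no neighbour on P, then every vertex of
-- P has all its neighbours on the other side of v. Choose such a v with a neighbour w that is
-- adjacent to some x on P, say with x < v < w, and let a be the first vertex after v dominated by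
-- P. Let e ≤ l be neighbours on P of a and t, in either order, and r on P a neighbour of s.
-- Alternating between the two sides of v, there is a path from l to e whose left vertices decrease.
-- Its left vertices see every vertex of [a, t], hence w sees one of them and also v, hence l;
-- likewise r sees e. So w, l, …, e, r is a path, and it dominates v and everything P dominates.
module Submission where

open import Defs
open import Data.Nat using (ℕ; zero; suc; _*_; z≤n)
open import Data.Nat.Properties using (≤-refl; ≤⇒≯; n≮0)
open import Data.Empty using (⊥; ⊥-elim)
open import Data.Fin using (Fin; zero; suc; fromℕ; _<_; combine; remQuot)
open import Data.Fin.Induction using (spo-wellFounded)
open import Data.Fin.Properties using (any?; remQuot-combine; <-cmp; <-trans; <-irrefl; ≤fromℕ)
  renaming (_≟_ to _≟ᶠ_; _<?_ to _<ᶠ?_)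
open import Data.Fin.Subset using (Subset; _∈_; inside)
open import Data.Fin.Subset.Induction using (⊃-wellFounded)
open import Data.List using (List; []; _∷_; _++_; [_]; allFin; concatMap)
import Data.List.Membership.Propositional as L
open L using (find; lose)
open import Data.List.Membership.DecPropositional using () renaming (_∈?_ to mem?)
open import Data.List.Membership.Propositional.Properties
  using (∈-++⁺ˡ; ∈-++⁻; ∈-allFin; ∈-concatMap⁺; ∈-concatMap⁻)
open import Data.List.Relation.Unary.All.Properties using (¬Any⇒All¬)
open import Data.List.Relation.Unary.AllPairs using ([]; _∷_)
import Data.List.Relation.Unary.All as All
open import Data.List.Relation.Unary.Any as Any using (Any; here; there)
open import Data.List.Relation.Unary.Linked as Linked using (Linked; [-]; _∷_)
open import Data.List.Relation.Unary.Unique.Propositional using (Unique)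
open import Data.Product using (∃; ∃₂; _×_; _,_; proj₁; proj₂; uncurry)
open import Data.Product.Properties using (≡-dec)
open import Data.Sum as Sum using (_⊎_; inj₁; inj₂; [_,_]′; swap)
open import Data.Vec using (tabulate)
open import Data.Vec.Properties using (lookup∘tabulate; []=⇒lookup; lookup⇒[]=)
open import Function using (_∘_; flip; id)
open import Function.Bundles using (Bijection)
open import Induction.WellFounded using (Acc; acc)
open import Level using (0ℓ)
open import Relation.Binary using (Rel; Decidable; IsStrictTotalOrder; Trichotomous; tri<; tri≈; tri>)
import Relation.Binary.Construct.Flip.EqAndOrd as Flip
open import Relation.Binary.Construct.Closure.ReflexiveTransitive as Star using (Star; ε; _◅_; _◅◅_)
open import Relation.Binary.PropositionalEquality
  using (_≡_; _≢_; refl; sym; trans; cong; subst; ≢-sym; isEquivalence)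
open import Relation.Nullary using (¬_; Dec; yes; no; does; contradiction; ¬?)
open import Relation.Nullary.Decidable using (_×-dec_; _⊎-dec_; decidable-stable)
open import Relation.Unary using (Pred) renaming (Decidable to Decidable¹)

-- Iteration that strictly enlarges a finite set.

module _ {m} {Q : Pred (Fin m) 0ℓ} (Q? : Decidable¹ Q) where

  subset : Subset m
  subset = tabulate (does ∘ Q?)

  ∈-subset⁺ : ∀ {i} → Q i → i ∈ subset
  ∈-subset⁺ {i} q = lookup⇒[]= i subset (trans (lookup∘tabulate (does ∘ Q?) i) (dec-yes (Q? i)))
    where
    dec-yes : (d : Dec (Q i)) → does d ≡ inside
    dec-yes (yes _) = refl
    dec-yes (no ¬q) = contradiction q ¬q

  ∈-subset⁻ : ∀ {i} → i ∈ subset → Q i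
  ∈-subset⁻ {i} i∈ =
    dec-yes (Q? i) (trans (sym (lookup∘tabulate (does ∘ Q?) i)) ([]=⇒lookup i∈))
    where
    dec-yes : (d : Dec (Q i)) → does d ≡ inside → Q i
    dec-yes (yes q) _ = q

-- Strict inclusion of subsets of `Fin m` admits no infinite ascent. Used for the set dominated by a
-- path and for the closure of an edge list.
saturate : ∀ {m} {X Goal : Set} (Q : X → Pred (Fin m) 0ℓ) → (∀ x → Decidable¹ (Q x)) →
  (∀ x → Goal ⊎ ∃ λ x′ → (∀ {i} → Q x i → Q x′ i) × ∃ λ i → Q x′ i × ¬ Q x i) →
  X → Goal
saturate {X = X} {Goal} Q Q? step x = go x (⊃-wellFounded _)
  where
  go : ∀ x → Acc _ (subset (Q? x)) → Goal
  go x (acc rs) with step x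
  ... | inj₁ g = g
  ... | inj₂ (x′ , Q⊆Q′ , i , q′ , ¬q) = go x′ (rs
    ( (λ {_} → ∈-subset⁺ (Q? x′) ∘ Q⊆Q′ ∘ ∈-subset⁻ (Q? x))
    , i , ∈-subset⁺ (Q? x′) q′ , ¬q ∘ ∈-subset⁻ (Q? x)))

-- Paths and total domination.

module DecidableGraph {n : ℕ} (_~_ : Rel (Fin n) 0ℓ) (_~?_ : Decidable _~_)
  (~-sym : ∀ {u v} → u ~ v → v ~ u) (~-irrefl : ∀ {u} → ¬ u ~ u) where

  V = Fin n

  _∈?_ : Decidable {A = V} L._∈_
  _∈?_ = mem? _≟ᶠ_

  -- Total domination: members of P need a neighbour in P as well.
  Dom : List V → V → Set
  Dom P x = Any (_~ x) P

  dom? : ∀ P → Decidable¹ (Dom P)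
  dom? P x = Any.any? (_~? x) P

  -- The list omits the first vertex, so the full vertex list `x ∷ C` is visibly nonempty.
  data Path (e : V) : V → List V → Set where
    end  : Path e e []
    step : ∀ {x y C} → x ~ y → ¬ x L.∈ y ∷ C → Path e y C → Path e x (y ∷ C)

  path-linked : ∀ {e x C} → Path e x C → Linked _~_ (x ∷ C)
  path-linked end            = [-]
  path-linked (step x~y _ p) = x~y ∷ path-linked p

  path-unique : ∀ {e x C} → Path e x C → Unique (x ∷ C)
  path-unique end          = All.[] ∷ []
  path-unique (step _ x∉ p) = ¬Any⇒All¬ _ x∉ ∷ path-unique p

  end∈ : ∀ {e x C} → Path e x C → e L.∈ x ∷ C
  end∈ end          = here refl
  end∈ (step _ _ p) = there (end∈ p)

  path-snoc : ∀ {e x C r} → Path e x C → e ~ r → ¬ r L.∈ x ∷ C → Path r x (C ++ [ r ])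
  path-snoc end e~r r∉ = step e~r (λ { (here refl) → r∉ (here refl) }) end
  path-snoc (step {C = C} x~y x∉ p) e~r r∉ =
    step x~y (λ x∈ → [ x∉ , (λ { (here refl) → r∉ (here refl) }) ]′ (∈-++⁻ (_ ∷ C) x∈))
      (path-snoc p e~r (r∉ ∘ there))

  path-suffix : ∀ {e x y C} → x L.∈ y ∷ C → Path e y C → ∃ (Path e x)
  path-suffix (here refl) p            = _ , p
  path-suffix (there x∈)  (step _ _ p) = path-suffix x∈ p

  erase-loops : ∀ {x e} → Star _~_ x e → ∃ (Path e x)
  erase-loops ε = _ , end
  erase-loops {x} (_◅_ {j = y} x~y w) with erase-loops w
  ... | C , p with x ∈? (y ∷ C)
  ...   | yes x∈ = path-suffix x∈ p
  ...   | no  x∉ = _ , step x~y x∉ p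

  EdgeIn : List V → Rel V 0ℓ
  EdgeIn P p q = p ~ q × p L.∈ P × q L.∈ P

  -- All that is used of an old path; the order of its vertices is forgotten. By `partner`, an
  -- undominated vertex is never on `P`.
  record Spread (P : List V) : Set where
    field
      partner   : ∀ {p} → p L.∈ P → Dom P p
      connected : ∀ {p q} → p L.∈ P → q L.∈ P → Star (EdgeIn P) p q

  module _ {e x : V} {C : List V} (path : Path e x C) where
    private
      P = x ∷ C

      toEnd : ∀ {y D p} → Path e y D → p L.∈ y ∷ D → Star (EdgeIn (y ∷ D)) p e
      toEnd end (here refl) = ε
      toEnd (step y~z y∉ p) (here refl) =
        (y~z , here refl , there (here refl)) ◅
        Star.map (λ (a , b , c) → a , there b , there c) (toEnd p (here refl))
      toEnd (step _ _ p) (there q∈) =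
        Star.map (λ (a , b , c) → a , there b , there c) (toEnd p q∈)

      conn : ∀ {p q} → p L.∈ P → q L.∈ P → Star (EdgeIn P) p q
      conn p∈ q∈ = toEnd path p∈ ◅◅
        Star.reverse (λ (a , b , c) → ~-sym a , c , b) (toEnd path q∈)

      neighbour : ∀ {p q} → p ≢ q → Star (EdgeIn P) p q → Dom P p
      neighbour p≢q ε = contradiction refl p≢q
      neighbour _ ((p~y , _ , y∈) ◅ _) = lose y∈ (~-sym p~y)

    path-spread : x ≢ e → Spread P
    path-spread x≢e = record { partner = partner ; connected = conn }
      where
      partner : ∀ {p} → p L.∈ P → Dom P p
      partner {p} p∈ with p ≟ᶠ x
      ... | yes refl = neighbour x≢e (conn p∈ (end∈ path))
      ... | no  p≢x  = neighbour p≢x (conn p∈ (here refl))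

  Simple : List V → Set
  Simple P = ¬ P ≡ [] × Unique P × Linked _~_ P

  record Progress (P : List V) (v : V) : Set where
    field
      next   : List V
      simple : Simple next
      spread : Spread next
      keeps  : ∀ {y} → Dom P y → Dom next y
      gains  : Dom next v

  -- Linear orders with the convexity rule.

  record Layout : Set₁ where
    field
      _≺_   : Rel V 0ℓ
      isSTO : IsStrictTotalOrder _≡_ _≺_
      conv  : ∀ {u a b c} → a ≺ b → b ≺ c → u ~ a → u ~ c → u ≢ b → u ~ b
      s t   : V
      s-min : ∀ {x} → ¬ x ≺ s
      t-max : ∀ {x} → ¬ t ≺ x
    open IsStrictTotalOrder isSTO public
      using (compare; irrefl; asym; isStrictPartialOrder; _<?_) renaming (trans to ≺-trans)

    ≺⇒≢ : ∀ {x y} → x ≺ y → x ≢ y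
    ≺⇒≢ x≺y refl = irrefl refl x≺y

    _≼_ : Rel V 0ℓ
    x ≼ y = x ≡ y ⊎ x ≺ y

    ≼-total : ∀ x y → x ≼ y ⊎ y ≼ x
    ≼-total x y with compare x y
    ... | tri< x≺y _ _ = inj₁ (inj₂ x≺y)
    ... | tri≈ _ x≡y _ = inj₁ (inj₁ x≡y)
    ... | tri> _ _ y≺x = inj₂ (inj₂ y≺x)

    ≼-≺-trans : ∀ {x y z} → x ≼ y → y ≺ z → x ≺ z
    ≼-≺-trans (inj₁ refl) q = q
    ≼-≺-trans (inj₂ p)    q = ≺-trans p q

    ≺-≼-trans : ∀ {x y z} → x ≺ y → y ≼ z → x ≺ z
    ≺-≼-trans p (inj₁ refl) = p
    ≺-≼-trans p (inj₂ q)    = ≺-trans p q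

    ≼-trans : ∀ {x y z} → x ≼ y → y ≼ z → x ≼ z
    ≼-trans (inj₁ refl) q = q
    ≼-trans (inj₂ p)    q = inj₂ (≺-≼-trans p q)

    s≼ : ∀ x → s ≼ x
    s≼ x with ≼-total s x
    ... | inj₁ p           = p
    ... | inj₂ (inj₁ refl) = inj₁ refl
    ... | inj₂ (inj₂ x≺s)  = contradiction x≺s s-min

    ≼t : ∀ x → x ≼ t
    ≼t x with ≼-total x t
    ... | inj₁ p           = p
    ... | inj₂ (inj₁ refl) = inj₁ refl
    ... | inj₂ (inj₂ t≺x)  = contradiction t≺x t-max

    convʷ : ∀ {u a b c} → a ≼ b → b ≼ c → u ~ a → u ~ c → u ≢ b → u ~ b
    convʷ (inj₁ refl) _           u~a _   _   = u~a
    convʷ (inj₂ _)    (inj₁ refl) _   u~c _   = u~c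
    convʷ (inj₂ a≺b)  (inj₂ b≺c)  u~a u~c u≢b = conv a≺b b≺c u~a u~c u≢b

    minimal : {Q : Pred V 0ℓ} → Decidable¹ Q → ∀ {x} → Q x →
      ∃ λ a → Q a × ∀ {y} → Q y → a ≼ y
    minimal {Q} Q? {x} q = go x q (spo-wellFounded isStrictPartialOrder x)
      where
      go : ∀ x → Q x → Acc _≺_ x → ∃ λ a → Q a × ∀ {y} → Q y → a ≼ y
      go x q (acc rs) with any? (λ y → (y <? x) ×-dec Q? y)
      ... | yes (y , y≺x , q′) = go y q′ (rs y≺x)
      ... | no none = x , q , least
        where
        least : ∀ {y} → Q y → x ≼ y
        least {y} q′ with ≼-total x y
        ... | inj₁ p           = p
        ... | inj₂ (inj₁ refl) = inj₁ refl
        ... | inj₂ (inj₂ y≺x)  = contradiction (y , y≺x , q′) none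

  -- The hypotheses survive reversal of the order, so every claim about one side of `v` yields its
  -- mirror image.
  reflect : Layout → Layout
  reflect O = record
    { _≺_ = flip _≺_ ; isSTO = Flip.isStrictTotalOrder isSTO
    ; conv = λ b≺a c≺b u~a u~c → conv c≺b b≺a u~c u~a
    ; s = t ; t = s ; s-min = t-max ; t-max = s-min }
    where open Layout O

  -- The two sides of an undominated vertex.

  module _ (O : Layout) {P : List V} (spread : Spread P)
    (Ps : Dom P (Layout.s O)) (Pt : Dom P (Layout.t O)) {v : V} (¬Pv : ¬ Dom P v) where

    open Layout O
    open Spread spread

    private
      one-sided : ∀ {p a c} → p L.∈ P → p ~ a → a ≺ v → p ~ c → v ≺ c → ⊥
      one-sided p∈ p~a a≺v p~c v≺c =
        ¬Pv (lose p∈ (conv a≺v v≺c p~a p~c (λ { refl → ¬Pv (partner p∈) })))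

      Below : V → Set
      Below p = ∃ λ q → p ~ q × q ≺ v

      -- By `one-sided`, the next vertex `y` of the walk cannot lie right of `v`; hence `p` itself
      -- is its neighbour below `v`.
      below-spreads : ∀ {p q} → Star (EdgeIn P) p q → p ≺ v → Below p → Below q
      below-spreads ε _ bp = bp
      below-spreads {p} (_◅_ {j = y} (p~y , p∈ , y∈) w) p≺v (q , p~q , q≺v) with compare y v
      ... | tri< y≺v _ _ = below-spreads w y≺v (p , ~-sym p~y , p≺v)
      ... | tri≈ _ refl _ = contradiction (lose p∈ p~y) ¬Pv
      ... | tri> _ _ v≺y = ⊥-elim (one-sided p∈ p~q q≺v p~y v≺y)

    -- A left neighbour of a left vertex would propagate through `P` to the neighbour `p′` of `t`,
    -- which would then have neighbours on both sides of `v`.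
    alternating : ∀ {p q} → p L.∈ P → p ≺ v → p ~ q → v ≺ q
    alternating {p} {q} p∈ p≺v p~q with compare q v
    ... | tri> _ _ v≺q = v≺q
    ... | tri≈ _ refl _ = contradiction (lose p∈ p~q) ¬Pv
    ... | tri< q≺v _ _ with find Pt
    ...   | p′ , p′∈ , p′~t with below-spreads (connected p∈ p′∈) p≺v (q , p~q , q≺v) | ≼t v
    ...     | _                  | inj₁ refl = contradiction Pt ¬Pv
    ...     | q′ , p′~q′ , q′≺v | inj₂ v≺t  = ⊥-elim (one-sided p′∈ p′~q′ q′≺v p′~t v≺t)

  -- Alternating paths with decreasing left vertices.

  module _ (O : Layout) {P : List V} (spread : Spread P)
    (Ps : Dom P (Layout.s O)) (Pt : Dom P (Layout.t O)) {v : V} (¬Pv : ¬ Dom P v) where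

    open Layout O
    open Spread spread

    private
      up : ∀ {p q} → p L.∈ P → p ≺ v → p ~ q → v ≺ q
      up = alternating O spread Ps Pt ¬Pv

      down : ∀ {p q} → p L.∈ P → v ≺ p → p ~ q → q ≺ v
      down = alternating (reflect O) spread Pt Ps ¬Pv

    -- Only repetition of a right vertex `ρ` is excluded by hand: left vertices decrease, and `v`
    -- separates the two kinds.
    data Descent (e : V) : V → List V → Set where
      end  : e ≺ v → Descent e e []
      step : ∀ {z ρ z′ C} → z ≺ v → z ~ ρ → ρ ~ z′ → v ≺ ρ → ρ L.∈ P → z′ ≺ z →
             ¬ ρ L.∈ C → Descent e z′ C → Descent e z (ρ ∷ z′ ∷ C)

    end≼ : ∀ {e z C} → Descent e z C → e ≼ z
    end≼ (end _)                     = inj₁ refl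
    end≼ (step _ _ _ _ _ z′≺z _ D) = inj₂ (≼-≺-trans (end≼ D) z′≺z)

    start≺ : ∀ {e z C} → Descent e z C → z ≺ v
    start≺ (end e≺v)                = e≺v
    start≺ (step z≺v _ _ _ _ _ _ _) = z≺v

    -- Later this keeps `w` off the descent, since `w` is right of `v` and not on `P`.
    descent-tail : ∀ {e z C y} → Descent e z C → y L.∈ C → y ≺ z ⊎ v ≺ y × y L.∈ P
    descent-tail (step _ _ _ v≺ρ ρ∈ _ _ _) (here refl) = inj₂ (v≺ρ , ρ∈)
    descent-tail (step _ _ _ _ _ z′≺z _ _) (there (here refl)) = inj₁ z′≺z
    descent-tail (step _ _ _ _ _ z′≺z _ D) (there (there y∈)) with descent-tail D y∈
    ... | inj₁ y≺z′ = inj₁ (≺-trans y≺z′ z′≺z)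
    ... | inj₂ r    = inj₂ r

    ∉-descent : ∀ {e z C y} → Descent e z C → v ≺ y → ¬ y L.∈ C → ¬ y L.∈ z ∷ C
    ∉-descent D v≺y y∉ (here refl) = asym v≺y (start≺ D)
    ∉-descent D v≺y y∉ (there y∈)  = y∉ y∈

    descent-path : ∀ {e z C} → Descent e z C → Path e z C
    descent-path (end _) = end
    descent-path {z = z} D@(step {C = C} z≺v z~ρ ρ~z′ v≺ρ _ z′≺z ρ∉ D′) =
      step z~ρ z∉ (step ρ~z′ (∉-descent D′ v≺ρ ρ∉) (descent-path D′))
      where
      z∉ : ¬ z L.∈ _
      z∉ z∈ with descent-tail D z∈
      ... | inj₁ z≺z       = irrefl refl z≺z
      ... | inj₂ (v≺z , _) = asym v≺z z≺v

    descent-suffix : ∀ {e z C ρ} → Descent e z C → v ≺ ρ → ρ L.∈ C →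
      ∃₂ λ z′ C′ → ρ ~ z′ × z′ ≺ z × ¬ ρ L.∈ C′ × Descent e z′ C′
    descent-suffix (step _ _ ρ~z′ _ _ z′≺z ρ∉ D) _ (here refl) = _ , _ , ρ~z′ , z′≺z , ρ∉ , D
    descent-suffix (step _ _ _ _ _ _ _ D) v≺ρ (there (here refl)) = ⊥-elim (asym v≺ρ (start≺ D))
    descent-suffix (step _ _ _ _ _ z′≺z _ D) v≺ρ (there (there ρ∈)) with descent-suffix D v≺ρ ρ∈
    ... | _ , _ , ρ~z″ , z″≺z′ , ρ∉ , D″ = _ , _ , ρ~z″ , ≺-trans z″≺z′ z′≺z , ρ∉ , D″

    descent-restart : ∀ {e z C l} → Descent e z C → l ≼ z → e ≺ l → l ≺ v → ∃ (Descent e l)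
    descent-restart D (inj₁ refl) _ _ = _ , D
    descent-restart (end _) (inj₂ l≺e) e≺l _ = ⊥-elim (asym e≺l l≺e)
    descent-restart {l = l} (step {z′ = z′} z≺v z~ρ ρ~z′ v≺ρ ρ∈ _ ρ∉ D) (inj₂ l≺z) e≺l l≺v
      with compare z′ l
    ... | tri< z′≺l _ _ = _ , step l≺v
            (~-sym (conv z′≺l l≺z ρ~z′ (~-sym z~ρ) (≢-sym (≺⇒≢ (≺-trans l≺v v≺ρ)))))
            ρ~z′ v≺ρ ρ∈ z′≺l ρ∉ D
    ... | tri≈ _ refl _ = _ , D
    ... | tri> _ _ l≺z′ = descent-restart D (inj₂ l≺z′) e≺l l≺v

    descent-extend : ∀ {e z C l ρ} → Descent e z C → l ~ ρ → ρ ~ z → v ≺ ρ → ρ L.∈ P →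
      e ≺ l → l ≺ v → ∃ (Descent e l)
    descent-extend {z = z} {C} {l} {ρ} D l~ρ ρ~z v≺ρ ρ∈ e≺l l≺v with compare z l
    ... | tri≈ _ refl _ = _ , D
    ... | tri> _ _ l≺z = descent-restart D (inj₂ l≺z) e≺l l≺v
    ... | tri< z≺l _ _ with ρ ∈? C
    ...   | no ρ∉ = _ , step l≺v l~ρ ρ~z v≺ρ ρ∈ z≺l ρ∉ D
    -- The descent already visits `ρ`; everything before that visit is cut out.
    ...   | yes ρ∈C with descent-suffix D v≺ρ ρ∈C
    ...     | _ , _ , ρ~z′ , z′≺z , ρ∉ , D′ =
              _ , step l≺v l~ρ ρ~z′ v≺ρ ρ∈ (≺-trans z′≺z z≺l) ρ∉ D′

    -- A walk inside `P` changes sides at every edge, so it is read two edges at a time, as `l`,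
    -- `ρ`, `z`. If `z` drops below `e`, then `conv` joins `ρ` to `e` and the descent stops there.
    descent : ∀ {l e} → Star (EdgeIn P) l e → e ≼ l → l ≺ v → e ≺ v → ∃ (Descent e l)
    descent _ (inj₁ refl) _ e≺v = _ , end e≺v
    descent ε (inj₂ _) _ e≺v = _ , end e≺v
    descent ((l~e , l∈ , _) ◅ ε) (inj₂ _) l≺v e≺v = ⊥-elim (asym e≺v (up l∈ l≺v l~e))
    descent {l} {e} ((l~ρ , l∈ , ρ∈) ◅ (_◅_ {j = z} (ρ~z , _ , _) w)) (inj₂ e≺l) l≺v e≺v
      with up l∈ l≺v l~ρ | compare z e
    ... | v≺ρ | tri< z≺e _ _ = _ , step l≺v l~ρ
            (conv z≺e e≺l ρ~z (~-sym l~ρ) (≢-sym (≺⇒≢ (≺-trans e≺v v≺ρ))))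
            v≺ρ ρ∈ e≺l (λ ()) (end e≺v)
    ... | v≺ρ | tri≈ _ refl _ = _ , step l≺v l~ρ ρ~z v≺ρ ρ∈ e≺l (λ ()) (end e≺v)
    ... | v≺ρ | tri> _ _ e≺z with descent w (inj₂ e≺z) (down ρ∈ v≺ρ ρ~z) e≺v
    ...   | _ , D = descent-extend D l~ρ ρ~z v≺ρ ρ∈ e≺l l≺v

    -- Generic in _⊴_ because the descent may run from the left end of the interval to its right
    -- end or the other way round.
    descent-covers : {_⊴_ : Rel V 0ℓ} → (∀ x y → x ⊴ y ⊎ y ⊴ x) →
      (∀ {u a b c} → a ⊴ b → b ⊴ c → u ~ a → u ~ c → u ≢ b → u ~ b) →
      ∀ {e l C q y q′} → Descent e l C → v ≺ y → l ~ q → q ⊴ y → e ~ q′ → y ⊴ q′ →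
      ∃ λ z → e ≼ z × z ≼ l × z ~ y
    descent-covers total conv⊴ (end e≺v) v≺y l~q q⊴y e~q′ y⊴q′ =
      _ , inj₁ refl , inj₁ refl , conv⊴ q⊴y y⊴q′ l~q e~q′ (≺⇒≢ (≺-trans e≺v v≺y))
    descent-covers total conv⊴ {y = y} D@(step {ρ = ρ} z≺v z~ρ ρ~z′ _ _ z′≺z _ D′)
      v≺y l~q q⊴y e~q′ y⊴q′
      -- A discrete intermediate value argument: either `ρ` has passed `y`, and `z` has neighbours
      -- on both sides of `y`, or `ρ` takes over the role of `q` for `z′`.
      with total y ρ
    ... | inj₁ y⊴ρ = _ , end≼ D , inj₁ refl , conv⊴ q⊴y y⊴ρ l~q z~ρ (≺⇒≢ (≺-trans z≺v v≺y))
    ... | inj₂ ρ⊴y with descent-covers total conv⊴ D′ v≺y (~-sym ρ~z′) ρ⊴y e~q′ y⊴q′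
    ...   | z″ , e≼z″ , z″≼z′ , z″~y = z″ , e≼z″ , inj₂ (≼-≺-trans z″≼z′ z′≺z) , z″~y

    -- Rerouting the path through `w`.

    private
      left-dominator : ∀ {y} → v ≺ y → Dom P y → ∃ λ p → p L.∈ P × p ≺ v × p ~ y
      left-dominator v≺y Py with find Py
      ... | p , p∈ , p~y with compare p v
      ...   | tri< p≺v _ _ = p , p∈ , p≺v , p~y
      ...   | tri≈ _ refl _ = contradiction (partner p∈) ¬Pv
      ...   | tri> _ _ v≺p = ⊥-elim (asym v≺y (down p∈ v≺p p~y))

      right-dominator : ∀ {y} → y ≺ v → Dom P y → ∃ λ p → p L.∈ P × v ≺ p × p ~ y
      right-dominator y≺v Py with find Py
      ... | p , p∈ , p~y with compare p v
      ...   | tri> _ _ v≺p = p , p∈ , v≺p , p~y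
      ...   | tri≈ _ refl _ = contradiction (partner p∈) ¬Pv
      ...   | tri< p≺v _ _ = ⊥-elim (asym y≺v (up p∈ p≺v p~y))

      s≺v : s ≺ v
      s≺v with s≼ v
      ... | inj₁ refl = contradiction Ps ¬Pv
      ... | inj₂ s≺v  = s≺v

      v≺t : v ≺ t
      v≺t with ≼t v
      ... | inj₁ refl = contradiction Pt ¬Pv
      ... | inj₂ v≺t  = v≺t

    module _ {w a lₐ lₜ r : V} (v~w : v ~ w) (v≺w : v ≺ w) (Pw : Dom P w)
      (v≺a : v ≺ a) (a-least : ∀ {y} → v ≺ y × Dom P y → a ≼ y)
      (lₐ≺v : lₐ ≺ v) (lₐ~a : lₐ ~ a) (lₜ~t : lₜ ~ t)
      (r∈ : r L.∈ P) (v≺r : v ≺ r) (r~s : r ~ s) where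

      private
        w∉P : ¬ w L.∈ P
        w∉P w∈ = ¬Pv (lose w∈ (~-sym v~w))

      -- The new path again dominates `s` and `t`, so `alternating` applies to it at any vertex `y`
      -- that it fails to dominate.
      extends : ∀ {e C} → Path e w C → w ≢ e →
        r L.∈ w ∷ C → lₐ L.∈ w ∷ C → lₜ L.∈ w ∷ C → Progress P v
      extends {C = C} path w≢e r∈′ lₐ∈′ lₜ∈′ = record
        { next   = w ∷ C
        ; simple = (λ ()) , path-unique path , path-linked path
        ; spread = spread′
        ; keeps  = keeps
        ; gains  = P′v
        }
        where
        P′ = w ∷ C
        spread′ = path-spread path w≢e
        P′s = lose r∈′ r~s
        P′t = lose lₜ∈′ lₜ~t
        P′v = here (~-sym v~w)

        keeps : ∀ {y} → Dom P y → Dom P′ y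
        keeps {y} Py = decidable-stable (dom? P′ y) absurd
          where
          absurd : ¬ ¬ Dom P′ y
          absurd ¬P′y with compare y v
          ... | tri≈ _ refl _ = ¬P′y P′v
          -- The edge from `w` to `v` would lie entirely to the right of `y`.
          ... | tri< y≺v _ _ = asym y≺v
                  (alternating (reflect O) spread′ P′t P′s ¬P′y
                    (here refl) (≺-trans y≺v v≺w) (~-sym v~w))
          ... | tri> _ _ v≺y with a-least (v≺y , Py)
          ...   | inj₁ refl = ¬P′y (lose lₐ∈′ lₐ~a)
          -- The edge from `lₐ` to `a` would lie entirely to the left of `y`.
          ...   | inj₂ a≺y  = asym a≺y
                  (alternating O spread′ P′s P′t ¬P′y lₐ∈′ (≺-trans lₐ≺v v≺y) lₐ~a)

      -- Here `l` and `e` stand for `lₐ` and `lₜ` in whichever order they occur; `covers` and `ends`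
      -- hide that choice.
      reroute : ∀ {l e} → l L.∈ P → e L.∈ P → e ≼ l → l ≺ v → e ≺ v →
        (∀ {C y} → Descent e l C → v ≺ y → a ≼ y → ∃ λ z → e ≼ z × z ≼ l × z ~ y) →
        (∀ {P′} → l L.∈ P′ → e L.∈ P′ → lₐ L.∈ P′ × lₜ L.∈ P′) →
        Progress P v
      reroute {l} {e} l∈ e∈ e≼l l≺v e≺v covers ends
        with descent (connected l∈ e∈) e≼l l≺v e≺v
      ... | C , D
        with covers D v≺w (a-least (v≺w , Pw)) | covers D v≺r (a-least (v≺r , partner r∈))
      ... | z , _ , z≼l , z~w | z′ , e≼z′ , _ , z′~r = result
        where
        w~l : w ~ l
        -- `l` lies between `z` and `v`, both neighbours of `w`.
        w~l = convʷ z≼l (inj₂ l≺v) (~-sym z~w) (~-sym v~w) (≢-sym (≺⇒≢ (≺-trans l≺v v≺w)))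

        e~r : e ~ r
        -- `e` lies between `s` and `z′`, both neighbours of `r`.
        e~r = ~-sym (convʷ (s≼ e) e≼z′ r~s (~-sym z′~r) (≢-sym (≺⇒≢ (≺-trans e≺v v≺r))))

        w∉C : ¬ w L.∈ C
        w∉C w∈ with descent-tail D w∈
        ... | inj₁ w≺l       = asym w≺l (≺-trans l≺v v≺w)
        ... | inj₂ (_ , w∈P) = w∉P w∈P

        path : Path e w (l ∷ C)
        path = step w~l (∉-descent D v≺w w∉C) (descent-path D)

        result : Progress P v
        result with r ∈? C
        -- If the descent passes through `r`, the path ends at `e`; otherwise `r` is appended.
        ... | yes r∈C =
              let lₐ∈′ , lₜ∈′ = ends (there (here refl)) (end∈ path)
              in extends path (≢-sym (≺⇒≢ (≺-trans e≺v v≺w))) (there (there r∈C)) lₐ∈′ lₜ∈′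
        ... | no r∉C =
              let path′ = path-snoc path e~r
                    λ { (here refl) → w∉P r∈ ; (there r∈′) → ∉-descent D v≺r r∉C r∈′ }
                  lₐ∈′ , lₜ∈′ = ends (there (here refl)) (∈-++⁺ˡ (end∈ path))
              in extends path′ (λ { refl → w∉P r∈ }) (end∈ path′) lₐ∈′ lₜ∈′

    advance : ∀ {w x} → v ~ w → x L.∈ P → x ~ w → x ≺ v → Progress P v
    advance {w} {x} v~w x∈ x~w x≺v
      with up x∈ x≺v x~w
    ... | v≺w
      with minimal (λ y → (v <? y) ×-dec dom? P y) (v≺w , lose x∈ x~w)
    ... | a , (v≺a , Pa) , a-least
      with left-dominator v≺a Pa | left-dominator v≺t Pt | right-dominator s≺v Ps
    ... | lₐ , lₐ∈ , lₐ≺v , lₐ~a | lₜ , lₜ∈ , lₜ≺v , lₜ~t | r , r∈ , v≺r , r~s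
      with ≼-total lₐ lₜ
        | reroute v~w v≺w (lose x∈ x~w) v≺a a-least lₐ≺v lₐ~a lₜ~t r∈ v≺r r~s
    -- The descent starts at the neighbour of `t` and ends at that of `a`, so the right side is
    -- swept from `t` back to `a`, in the reversed order.
    ...   | inj₁ lₐ≼lₜ | build = build lₜ∈ lₐ∈ lₐ≼lₜ lₜ≺v lₐ≺v
              (λ D v≺y a≼y → descent-covers (flip ≼-total) (λ p q u~a u~c → convʷ q p u~c u~a)
                D v≺y lₜ~t (≼t _) lₐ~a a≼y)
              (λ l∈′ e∈′ → e∈′ , l∈′)
    ...   | inj₂ lₜ≼lₐ | build = build lₐ∈ lₜ∈ lₜ≼lₐ lₐ≺v lₜ≺v
              (λ D v≺y a≼y → descent-covers ≼-total convʷ D v≺y lₐ~a a≼y lₜ~t (≼t _))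
              _,_

  -- From a path between `s` and `t` to a dominating path.

  module _ (O : Layout) (connected : ∀ u v → Star _~_ u v)
    (s≢t : Layout.s O ≢ Layout.t O) where

    open Layout O

    private
      boundary : ∀ {P u p} → Star _~_ u p → ¬ Dom P u → Dom P p →
        ∃₂ λ v w → ¬ Dom P v × Dom P w × v ~ w
      boundary ε ¬Pu Pu = contradiction Pu ¬Pu
      boundary {P} (_◅_ {j = y} u~y walk) ¬Pu Pp with dom? P y
      ... | yes Py = _ , _ , ¬Pu , Py , u~y
      ... | no ¬Py = boundary walk ¬Py Pp

      -- The vertex gained need not be `v`: `advance` requires a neighbour dominated by `P`, so the
      -- walk from `v` to `s` is followed until domination begins.
      improve : ∀ {P} → Spread P → Dom P s → Dom P t → ∀ {v} → ¬ Dom P v →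
        ∃ λ v′ → ¬ Dom P v′ × Progress P v′
      improve spread Ps Pt {v} ¬Pv with boundary (connected v s) ¬Pv Ps
      ... | v′ , w , ¬Pv′ , Pw , v′~w with find Pw
      ...   | x , x∈ , x~w with compare x v′
      ...     | tri< x≺v _ _ = v′ , ¬Pv′ , advance O spread Ps Pt ¬Pv′ v′~w x∈ x~w x≺v
      ...     | tri≈ _ refl _ = contradiction (Spread.partner spread x∈) ¬Pv′
      ...     | tri> _ _ v≺x = v′ , ¬Pv′ , advance (reflect O) spread Pt Ps ¬Pv′ v′~w x∈ x~w v≺x

      State : Set
      State = ∃ λ P → Simple P × Spread P × Dom P s × Dom P t

      initial : State
      initial with erase-loops (connected s t)
      ... | C , path = s ∷ C , ((λ ()) , path-unique path , path-linked path) , spread ,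
            Spread.partner spread (here refl) , Spread.partner spread (end∈ path)
        where spread = path-spread path s≢t

    dominating-path : ∃ λ P → Simple P × ∀ v → Dom P v
    dominating-path = saturate (Dom ∘ proj₁) (dom? ∘ proj₁) next-state initial
      where
      next-state : ∀ (S : State) → (∃ λ P → Simple P × ∀ v → Dom P v) ⊎
        ∃ λ (S′ : State) → (∀ {v} → Dom (proj₁ S) v → Dom (proj₁ S′) v) ×
          ∃ λ v → Dom (proj₁ S′) v × ¬ Dom (proj₁ S) v
      next-state (P , simple , spread , Ps , Pt) with any? (λ v → ¬? (dom? P v))
      ... | no  none = inj₁ (P , simple , λ v → decidable-stable (dom? P v) (λ ¬Pv → none (v , ¬Pv)))
      ... | yes (v , ¬Pv) with improve spread Ps Pt ¬Pv
      ...   | v′ , ¬Pv′ , progress = inj₂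
              ((next , simple′ , spread′ , keeps Ps , keeps Pt) , keeps , v′ , gains , ¬Pv′)
        where open Progress progress renaming (simple to simple′; spread to spread′)

-- Passage to a decidable subgraph.

Undirected : ∀ {n} → List (Fin n × Fin n) → Rel (Fin n) 0ℓ
Undirected E u v = (u , v) L.∈ E ⊎ (v , u) L.∈ E

undirected? : ∀ {n} (E : List (Fin n × Fin n)) → Decidable (Undirected E)
undirected? E u v = mem? (≡-dec _≟ᶠ_ _≟ᶠ_) (u , v) E ⊎-dec mem? (≡-dec _≟ᶠ_ _≟ᶠ_) (v , u) E

module _ {n : ℕ} (G : Graph n) where

  open Graph G renaming (sym to Adj-sym)

  private
    V = Fin n

    walk-edges : ∀ {u v k} → Walk G u v k → List (V × V)
    walk-edges []                    = []
    walk-edges (_∷_ {u} {v} _ walk) = (u , v) ∷ walk-edges walk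

    walk-edges-sound : ∀ {u v k x y} (W : Walk G u v k) → (x , y) L.∈ walk-edges W → Adj x y
    walk-edges-sound (u~v ∷ _) (here refl) = u~v
    walk-edges-sound (_ ∷ W)   (there e∈)  = walk-edges-sound W e∈

    walk-star : ∀ {u v k E} (W : Walk G u v k) → (∀ {e} → e L.∈ walk-edges W → e L.∈ E) →
      Star (Undirected E) u v
    walk-star []      _  = ε
    walk-star (_ ∷ W) W⊆ = inj₁ (W⊆ (here refl)) ◅ walk-star W (W⊆ ∘ there)

  -- One walk from `root` to each vertex suffices. Allowing any larger `E′` lets the list be closed
  -- under convexity afterwards.
  star-from-connected : (root : V) → Connected G →
    ∃ λ E → (∀ {u v} → (u , v) L.∈ E → Adj u v) ×
      (∀ {E′} → (∀ {e} → e L.∈ E → e L.∈ E′) → ∀ u v → Star (Undirected E′) u v)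
  star-from-connected root conn = edges , sound , star
    where
    from-root : V → List (V × V)
    from-root v = walk-edges (proj₂ (conn root v))

    edges : List (V × V)
    edges = concatMap from-root (allFin n)

    sound : ∀ {u v} → (u , v) L.∈ edges → Adj u v
    sound e∈ with find (∈-concatMap⁻ from-root {xs = allFin n} e∈)
    ... | w , _ , e∈w = walk-edges-sound (proj₂ (conn root w)) e∈w

    star : ∀ {E′} → (∀ {e} → e L.∈ edges → e L.∈ E′) → ∀ u v → Star (Undirected E′) u v
    star ⊆E′ u v = Star.reverse swap (reach u) ◅◅ reach v
      where
      reach : ∀ w → Star _ root w
      reach w = walk-star (proj₂ (conn root w))
        (λ e∈ → ⊆E′ (∈-concatMap⁺ from-root (lose (∈-allFin w) e∈)))

  module _ {_≺_ : Rel V 0ℓ} (_≺?_ : Decidable _≺_)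
    (conv : ∀ {u a b c} → a ≺ b → b ≺ c → Adj u a → Adj u c → u ≢ b → Adj u b)
    (E : List (V × V)) (E-sound : ∀ {u v} → (u , v) L.∈ E → Adj u v) where

    private
      record Extension : Set where
        field
          edges  : List (V × V)
          sound  : ∀ {u v} → (u , v) L.∈ edges → Adj u v
          ⊇E     : ∀ {e} → e L.∈ E → e L.∈ edges

        undirected-sound : ∀ {u v} → Undirected edges u v → Adj u v
        undirected-sound = [ sound , Adj-sym ∘ sound ]′

      open Extension

      Convex : List (V × V) → Set
      Convex E′ = ∀ {u a b c} → a ≺ b → b ≺ c →
        Undirected E′ u a → Undirected E′ u c → u ≢ b → Undirected E′ u b

    -- A subgraph need not inherit `conv`. Each violation is repaired by an edge that `conv`
    -- provides in `G`, and the pairs of vertices, coded in `Fin (n * n)`, are finite in number.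
    convex-closure : ∃ λ E′ → (∀ {e} → e L.∈ E → e L.∈ E′) ×
      (∀ {u v} → Undirected E′ u v → Adj u v) × Convex E′
    convex-closure = saturate {m = n * n} (λ X i → uncurry (Undirected (edges X)) (remQuot n i))
      (λ X i → undirected? (edges X) _ _) grow
      (record { edges = E ; sound = E-sound ; ⊇E = id })
      where
      Violation : List (V × V) → V → V → V → V → Set
      Violation E′ u b a c =
        (a ≺ b × b ≺ c) × (Undirected E′ u a × Undirected E′ u c) × u ≢ b × ¬ Undirected E′ u b

      violation? : ∀ E′ → Dec (∃ λ u → ∃ λ b → ∃ λ a → ∃ λ c → Violation E′ u b a c)
      violation? E′ = any? λ u → any? λ b → any? λ a → any? λ c →
        ((a ≺? b) ×-dec (b ≺? c)) ×-dec (undirected? E′ u a ×-dec undirected? E′ u c) ×-dec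
        ¬? (u ≟ᶠ b) ×-dec ¬? (undirected? E′ u b)

      grow : ∀ (X : Extension) → _ ⊎ _
      grow X with violation? (edges X)
      ... | no none = inj₁ (edges X , (λ {_} → ⊇E X) , (λ {_} {_} → undirected-sound X) ,
              λ {u} {a} {b} {c} a≺b b≺c ua uc u≢b →
              decidable-stable (undirected? (edges X) u b) λ ¬ub →
                none (u , b , a , c , (a≺b , b≺c) , (ua , uc) , u≢b , ¬ub))
      ... | yes (u , b , _ , _ , (a≺b , b≺c) , (ua , uc) , u≢b , ¬ub) = inj₂
              ( record
                  { edges = (u , b) ∷ edges X
                  ; sound = λ { (here refl) →
                                conv a≺b b≺c (undirected-sound X ua) (undirected-sound X uc) u≢b
                              ; (there e∈)  → sound X e∈ }
                  ; ⊇E = there ∘ ⊇E X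
                  }
              , (λ {_} → Sum.map there there)
              , combine u b
              , subst (uncurry (Undirected _)) (sym (remQuot-combine u b)) (inj₁ (here refl))
              , ¬ub ∘ subst (uncurry (Undirected _)) (remQuot-combine u b) )

theorem6 : (n : ℕ) (G : Graph (suc n)) → Connected G → StarC1P G → pe≤ G 1
-- With one vertex the first and last coincide, and there is no edge to start from.
theorem6 zero G _ _ = zero ∷ [] , ((λ ()) , All.[] ∷ [] , [-]) ,
  λ { zero → zero , here refl , 0 , z≤n , [] }
theorem6 (suc n) G conn (σ , c1p)
  with star-from-connected G zero conn
... | E , E-sound , star
  with convex-closure G (λ a b → pos a <ᶠ? pos b) conv E E-sound
  where
  open Bijection σ renaming (to to pos)
  conv : ∀ {u a b c} → pos a < pos b → pos b < pos c →
    Graph.Adj G u a → Graph.Adj G u c → u ≢ b → Graph.Adj G u b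
  conv {u} {a} {b} {c} a<b b<c ua uc u≢b with c1p u
  ... | inj₁ consecutive = consecutive a b c a<b b<c ua uc
  ... | inj₂ consecutive with consecutive a b c a<b b<c (inj₂ ua) (inj₂ uc)
  ...   | inj₁ u≡b = contradiction u≡b u≢b
  ...   | inj₂ ub  = ub
... | E′ , E⊆E′ , E′-sound , convex =
  let P , (P≢[] , unique , linked) , dom = dominating-path layout (star E⊆E′) s≢t
  in P , (P≢[] , unique , Linked.map E′-sound linked) ,
     λ v → let p , p∈ , p~v = find (dom v)
           in p , p∈ , 1 , ≤-refl , Graph.sym G (E′-sound p~v) ∷ []
  where
  open Bijection σ using (injective; surjective) renaming (to to pos)
  open DecidableGraph (Undirected E′) (undirected? E′) swap (Graph.irrefl G ∘ E′-sound)

  bottom : ∃ λ s → pos s ≡ zero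
  bottom = let s , eq = surjective zero in s , eq refl

  top : ∃ λ t → pos t ≡ fromℕ (suc n)
  top = let t , eq = surjective (fromℕ (suc n)) in t , eq refl

  s≢t : proj₁ bottom ≢ proj₁ top
  s≢t s≡t with trans (sym (proj₂ bottom)) (trans (cong pos s≡t) (proj₂ top))
  ... | ()

  cmp : Trichotomous _≡_ (λ a b → pos a < pos b)
  cmp a b with <-cmp (pos a) (pos b)
  ... | tri< lt ¬eq ¬gt = tri< lt (¬eq ∘ cong pos) ¬gt
  ... | tri≈ ¬lt eq ¬gt = tri≈ ¬lt (injective eq) ¬gt
  ... | tri> ¬lt ¬eq gt = tri> ¬lt (¬eq ∘ cong pos) gt

  layout : Layout
  layout = record
    { _≺_ = λ a b → pos a < pos b
    ; isSTO = record
        { isStrictPartialOrder = record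
            { isEquivalence = isEquivalence
            ; irrefl = λ { refl → <-irrefl refl }
            ; trans = <-trans
            ; <-resp-≈ = (λ { refl lt → lt }) , (λ { refl lt → lt })
            }
        ; compare = cmp
        }
    ; conv = convex
    ; s = proj₁ bottom
    ; t = proj₁ top
    ; s-min = λ {x} x<s → n≮0 (subst (pos x <_) (proj₂ bottom) x<s)
    ; t-max = λ {x} t<x → ≤⇒≯ (≤fromℕ (pos x)) (subst (_< pos x) (proj₂ top) t<x)
    }
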